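{- For all integers $n\ge 3$ and $1<k<n$, the edge connectivity of $G=H_B(n,k)$ is $\lambda(G)=1$.
   Context: Fix integers $n\ge 2$ and $1\le k<n$ and positive real numbers $x_1<x_2<\dots<x_n$. Let $\mathscr{B}_n=\{\pm x_1,\pm x_2,\dots,\pm x_{n-1},x_n\}$ (so $-x_n\notin\mathscr{B}_n$). Let $\phi(\mathscr{B}_n)$ be the family of all nonempty subsets $S\subseteq\mathscr{B}_n$ whose elements have pairwise distinct absolute values and whose element of largest absolute value is positive. Let $\mathscr{B}_n^+=\{x_1,\dots,x_n\}$, let $V_1$ be the set of all $k$-element subsets of $\mathscr{B}_n^+$, and let $V_2=\phi(\mathscr{B}_n)\setminus V_1$. For $A\in\phi(\mathscr{B}_n)$ put $A^\dagger=\{|a|:a\in A\}$. The bipartite Kneser B type-$k$ graph $H_B(n,k)$ is the simple graph with vertex set $V_1\cup V_2$ in which $X\in V_1$ and $Y\in V_2$ are adjacent if and only if $X\subseteq Y^\dagger$ or $Y^\dagger\subseteq X$, and there are no other edges. -}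

module Defs where

open import Data.Fin.Base using (Fin; splitAt; inject≤)
open import Data.Fin.Subset using (Subset) renaming (_∈_ to _∈ₛ_; ∣_∣ to card)
open import Data.List.Base using (List; length)
open import Data.List.Relation.Unary.All using (All)
open import Data.List.Relation.Unary.AllPairs using (AllPairs)
open import Data.List.Relation.Unary.Any as Any using (Any)
open import Data.Nat.Base as ℕ using (ℕ; _∸_)
open import Data.Nat.Properties using (m∸n≤m)
open import Data.Product.Base using (_×_; _,_; ∃-syntax; proj₁; uncurry; swap)
open import Data.Rational.Base as ℚ using (ℚ; 0ℚ)
import Data.Rational.Properties as ℚ
open import Data.Rational.Solver using (module +-*-Solver)
open import Data.Sum.Base using (_⊎_; inj₁; inj₂; [_,_]′)
open import Function.Base using (_∘_)
open import Level using (0ℓ)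
open import Relation.Binary.Construct.Closure.ReflexiveTransitive using (Star)
open import Relation.Binary.Construct.Closure.Symmetric using (SymClosure; fwd; bwd; symmetric)
open import Relation.Binary.Core using (Rel)
open import Relation.Binary.Definitions using (Symmetric)
open import Relation.Binary.PropositionalEquality
  using (_≡_; refl; sym; trans; cong; subst; subst₂)
open import Relation.Nullary.Negation using (¬_)
open import Relation.Unary using (Pred; _∈_; _⊆_; _∪_; Satisfiable)

------------------------------------------------------------------------
-- Real numbers, as Cauchy sequences of rationals up to _≈_

IsCauchy : (ℕ → ℚ) → Set
IsCauchy s = ∀ ε → 0ℚ ℚ.< ε →
  ∃[ N ] ∀ m n → N ℕ.≤ m → N ℕ.≤ n → ℚ.∣ s m ℚ.- s n ∣ ℚ.< ε

record ℝ : Set where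
  constructor mkℝ
  field
    seq    : ℕ → ℚ
    cauchy : IsCauchy seq

open ℝ public

infix 4 _≈_ _≉_ _<_ _≤_

_≈_ : Rel ℝ 0ℓ
x ≈ y = ∀ ε → 0ℚ ℚ.< ε →
  ∃[ N ] ∀ n → N ℕ.≤ n → ℚ.∣ seq x n ℚ.- seq y n ∣ ℚ.< ε

_≉_ : Rel ℝ 0ℓ
x ≉ y = ¬ (x ≈ y)

-- The termwise gap must be bounded away from 0: a merely termwise strict
-- inequality would not respect _≈_.
_<_ : Rel ℝ 0ℓ
x < y = ∃[ ε ] 0ℚ ℚ.< ε ×
  (∃[ N ] ∀ n → N ℕ.≤ n → seq x n ℚ.+ ε ℚ.≤ seq y n)

_≤_ : Rel ℝ 0ℓ
x ≤ y = ¬ (y < x)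

private
  module S = +-*-Solver

  neg-diff : ∀ p q → (ℚ.- p) ℚ.- (ℚ.- q) ≡ ℚ.- (p ℚ.- q)
  neg-diff p q = sym (ℚ.neg-distrib-+ p (ℚ.- q))

  ∣p∣-∣q∣≤∣p-q∣ : ∀ p q → ℚ.∣ p ∣ ℚ.- ℚ.∣ q ∣ ℚ.≤ ℚ.∣ p ℚ.- q ∣
  ∣p∣-∣q∣≤∣p-q∣ p q = begin
    ℚ.∣ p ∣ ℚ.- ℚ.∣ q ∣
      ≡⟨ cong (λ t → ℚ.∣ t ∣ ℚ.- ℚ.∣ q ∣)
           (S.solve 2 (λ a b → a S.:= (a S.:- b) S.:+ b) refl p q) ⟩
    ℚ.∣ (p ℚ.- q) ℚ.+ q ∣ ℚ.- ℚ.∣ q ∣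
      ≤⟨ ℚ.+-monoˡ-≤ (ℚ.- ℚ.∣ q ∣) (ℚ.∣p+q∣≤∣p∣+∣q∣ (p ℚ.- q) q) ⟩
    (ℚ.∣ p ℚ.- q ∣ ℚ.+ ℚ.∣ q ∣) ℚ.- ℚ.∣ q ∣
      ≡⟨ S.solve 2 (λ a b → (a S.:+ b) S.:- b S.:= a) refl ℚ.∣ p ℚ.- q ∣ ℚ.∣ q ∣ ⟩
    ℚ.∣ p ℚ.- q ∣ ∎
    where open ℚ.≤-Reasoning

  swap-diff : ∀ p q → ℚ.- (p ℚ.- q) ≡ q ℚ.- p
  swap-diff = S.solve 2 (λ a b → S.:- (a S.:- b) S.:= b S.:- a) refl

  ∣∣p∣-∣q∣∣≤∣p-q∣ : ∀ p q → ℚ.∣ ℚ.∣ p ∣ ℚ.- ℚ.∣ q ∣ ∣ ℚ.≤ ℚ.∣ p ℚ.- q ∣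
  ∣∣p∣-∣q∣∣≤∣p-q∣ p q with ℚ.∣p∣≡p∨∣p∣≡-p (ℚ.∣ p ∣ ℚ.- ℚ.∣ q ∣)
  ... | inj₁ eq = subst (ℚ._≤ ℚ.∣ p ℚ.- q ∣) (sym eq) (∣p∣-∣q∣≤∣p-q∣ p q)
  ... | inj₂ eq = subst₂ ℚ._≤_
    (sym (trans eq (swap-diff ℚ.∣ p ∣ ℚ.∣ q ∣)))
    (trans (cong ℚ.∣_∣ (sym (swap-diff p q))) (ℚ.∣-p∣≡∣p∣ (p ℚ.- q)))
    (∣p∣-∣q∣≤∣p-q∣ q p)

0ℝ : ℝ
0ℝ = mkℝ (λ _ → 0ℚ) (λ ε 0<ε → 0 , λ _ _ _ _ → 0<ε)

infix 8 -_

-_ : ℝ → ℝ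
- mkℝ s c = mkℝ (λ n → ℚ.- s n) λ ε 0<ε →
  let N , close = c ε 0<ε in
  N , λ m n N≤m N≤n → subst (ℚ._< ε)
        (sym (trans (cong ℚ.∣_∣ (neg-diff (s m) (s n))) (ℚ.∣-p∣≡∣p∣ (s m ℚ.- s n))))
        (close m n N≤m N≤n)

∣_∣ : ℝ → ℝ
∣ mkℝ s c ∣ = mkℝ (λ n → ℚ.∣ s n ∣) λ ε 0<ε →
  let N , close = c ε 0<ε in
  N , λ m n N≤m N≤n →
        ℚ.≤-<-trans (∣∣p∣-∣q∣∣≤∣p-q∣ (s m) (s n)) (close m n N≤m N≤n)

------------------------------------------------------------------------
-- Simple graphs and edge connectivity

-- The vertex set is a subset of an ambient type, on which _≡_ is equality of
-- vertices.
record SimpleGraph (A : Set) : Set₁ where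
  field
    Vertex     : Pred A 0ℓ
    Adj        : Rel A 0ℓ
    adj-vertex : ∀ {u v} → Adj u v → Vertex u
    adj-sym    : Symmetric Adj
    adj-irrefl : ∀ {u} → ¬ Adj u u

open SimpleGraph public

module _ {A : Set} where

  -- An ordered pair (u , v) stands for the undirected edge uv.
  SameEdge : Rel (A × A) 0ℓ
  SameEdge e f = e ≡ f ⊎ e ≡ swap f

  _∈ₑ_ : A × A → List (A × A) → Set
  e ∈ₑ F = Any (SameEdge e) F

  IsEdgeSet : SimpleGraph A → List (A × A) → Set
  IsEdgeSet G F = All (uncurry (Adj G)) F × AllPairs (λ e f → ¬ SameEdge e f) F

  private
    flipₑ : ∀ {u v} (f : A × A) → SameEdge (u , v) f → SameEdge (v , u) f
    flipₑ _ (inj₁ refl) = inj₂ refl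
    flipₑ _ (inj₂ refl) = inj₁ refl

  deleteEdges : SimpleGraph A → List (A × A) → SimpleGraph A
  deleteEdges G F = record
    { Vertex     = Vertex G
    ; Adj        = λ u v → Adj G u v × ¬ ((u , v) ∈ₑ F)
    ; adj-vertex = adj-vertex G ∘ proj₁
    ; adj-sym    = λ (uv , uv∉F) → adj-sym G uv , uv∉F ∘ Any.map (λ {f} → flipₑ f)
    ; adj-irrefl = adj-irrefl G ∘ proj₁
    }

  Connected : SimpleGraph A → Set
  Connected G = ∃⟨ Vertex G ⟩ ×
    (∀ {u v} → u ∈ Vertex G → v ∈ Vertex G → Star (Adj G) u v)

  Trivial : SimpleGraph A → Set
  Trivial G = ∀ {u v} → u ∈ Vertex G → v ∈ Vertex G → u ≡ v

  -- Graphs with at most one vertex get edge connectivity 0, the usual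
  -- convention.
  IsDisconnectingSet : SimpleGraph A → List (A × A) → Set
  IsDisconnectingSet G F = IsEdgeSet G F ×
    (¬ Connected (deleteEdges G F) ⊎ Trivial (deleteEdges G F))

  -- λ(G) = m
  EdgeConnectivity : SimpleGraph A → ℕ → Set
  EdgeConnectivity G m =
    (∃[ F ] IsDisconnectingSet G F × length F ≡ m) ×
    (∀ F → IsDisconnectingSet G F → m ℕ.≤ length F)

------------------------------------------------------------------------
-- The graph H_B(n,k); x lists x₁ < … < xₙ (0-based)

-- A subset of 𝓑ₙ is coded by the set of its indices in the enumeration 𝓑 below.
-- As 𝓑 is injective for 0 < x₁ < … < xₙ, subsets of 𝓑ₙ are equal iff their codes
-- are, and the cardinality of a subset is that of its code.
Code : ℕ → Set
Code n = Subset (n ℕ.+ (n ∸ 1))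

module _ {n : ℕ} (x : Fin n → ℝ) where

  -- Enumeration of 𝓑ₙ without repetitions: first x₁, …, xₙ, then
  -- -x₁, …, -xₙ₋₁.
  𝓑 : Fin (n ℕ.+ (n ∸ 1)) → ℝ
  𝓑 = [ x , (λ j → - x (inject≤ j (m∸n≤m n 1))) ]′ ∘ splitAt n

  𝓑⁺ : Pred ℝ 0ℓ
  𝓑⁺ r = ∃[ i ] r ≈ x i

  ⟦_⟧ : Code n → Pred ℝ 0ℓ
  ⟦ S ⟧ r = ∃[ i ] i ∈ₛ S × r ≈ 𝓑 i

  _† : Code n → Pred ℝ 0ℓ
  (S †) r = ∃[ a ] a ∈ ⟦ S ⟧ × r ≈ ∣ a ∣

  φ : Pred (Code n) 0ℓ
  φ S = ∃⟨ ⟦ S ⟧ ⟩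
      × (∀ {a b} → a ∈ ⟦ S ⟧ → b ∈ ⟦ S ⟧ → a ≉ b → ∣ a ∣ ≉ ∣ b ∣)
      × (∃[ a ] a ∈ ⟦ S ⟧ × (∀ {b} → b ∈ ⟦ S ⟧ → ∣ b ∣ ≤ ∣ a ∣) × 0ℝ < a)

  V₁ : ℕ → Pred (Code n) 0ℓ
  V₁ k S = ⟦ S ⟧ ⊆ 𝓑⁺ × card S ≡ k

  V₂ : ℕ → Pred (Code n) 0ℓ
  V₂ k S = S ∈ φ × ¬ (S ∈ V₁ k)

  Joined : ℕ → Rel (Code n) 0ℓ
  Joined k X Y = X ∈ V₁ k × Y ∈ V₂ k × (⟦ X ⟧ ⊆ Y † ⊎ Y † ⊆ ⟦ X ⟧)

H_B : (n k : ℕ) (x : Fin n → ℝ) → SimpleGraph (Code n)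
H_B n k x = record
  { Vertex     = V₁ x k ∪ V₂ x k
  ; Adj        = SymClosure (Joined x k)
  ; adj-vertex = λ { (fwd (X∈V₁ , _)) → inj₁ X∈V₁ ; (bwd (_ , Y∈V₂ , _)) → inj₂ Y∈V₂ }
  ; adj-sym    = symmetric (Joined x k)
  ; adj-irrefl = λ { (fwd (u∈V₁ , (_ , u∉V₁) , _)) → u∉V₁ u∈V₁
                   ; (bwd (u∈V₁ , (_ , u∉V₁) , _)) → u∉V₁ u∈V₁ }
  }

{-# OPTIONS --safe #-}

-- Replacing the least element of a k-element set X ∋ x₁ of positive elements by
-- its negative gives, as k ≥ 2, a vertex Y ∈ V₂ with Y† = X.  Since |Y†| = k, the
-- only neighbour of Y is X, so the edge XY disconnects the graph.  On the other
-- hand the graph is connected: all of V₁ is adjacent to {x₁, …, xₙ}, which lies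
-- in V₂ because k < n, and every Y ∈ V₂ has a neighbour in V₁, because some
-- k-element subset of {x₁, …, xₙ} is comparable with Y†.

module Submission where

open import Defs
open import Data.Nat.Base as ℕ using (ℕ; zero; suc; z≤n; s≤s; _∸_)
import Data.Nat.Properties as ℕ
open import Data.Fin.Base as Fin using (Fin; zero; suc; splitAt; inject≤; _↑ˡ_; _↑ʳ_)
import Data.Fin.Properties as Fin
open import Data.Fin.Subset
  using (Subset; inside; outside; ⊤; ⊥; ⁅_⁆; Nonempty)
  renaming (_∈_ to _∈ₛ_; _⊆_ to _⊆ₛ_; ∣_∣ to card)
open import Data.Fin.Subset.Properties
  using (_∈?_; nonempty?; ∉⊥; ∈⊤; ∣⊥∣≡0; ∣⊤∣≡n; x∈⁅x⁆;
         x∈⁅y⁆⇒x≡y; ⊆-antisym; p⊂q⇒∣p∣<∣q∣)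
open import Data.List.Base using ([]; _∷_)
open import Data.List.Relation.Unary.All using ([]; _∷_)
open import Data.List.Relation.Unary.AllPairs using ([]; _∷_)
open import Data.List.Relation.Unary.Any using (here)
open import Data.Product.Base using (_×_; _,_; ∃-syntax; proj₁)
open import Data.Rational.Base as ℚ using (ℚ; 0ℚ; ½)
import Data.Rational.Properties as ℚ
open import Data.Rational.Solver using (module +-*-Solver)
open import Data.Sum.Base as Sum using (_⊎_; inj₁; inj₂; [_,_]′)
open import Data.Vec.Base using ([]; _∷_; _++_; here; there)
open import Function.Base using (_∘_; id)
open import Level using (0ℓ)
open import Relation.Binary.Construct.Closure.ReflexiveTransitive
  using (Star; _◅_; _◅◅_; return; gmap) renaming (ε to nil)
open import Relation.Binary.Construct.Closure.Symmetric using (fwd; bwd)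
open import Relation.Binary.Core using (Rel)
open import Relation.Binary.Definitions using (tri<; tri≈; tri>)
open import Relation.Binary.PropositionalEquality
open import Relation.Nullary.Decidable using (yes; no; _×-dec_)
open import Relation.Nullary.Negation using (¬_; contradiction)
open import Relation.Unary using (Pred; Decidable; _∈_; _⊆_)

-- Order and absolute value on ℝ

infix 4 _≲_

-- A weak order given by explicit eventual bounds: these add up along a chain, and bounds in both
-- directions amount to `≈`. The negation `_≤_` is only met when membership in `φ` is shown.
_≲_ : Rel ℝ 0ℓ
x ≲ y = ∀ ε → 0ℚ ℚ.< ε →
  ∃[ N ] ∀ n → N ℕ.≤ n → seq x n ℚ.- seq y n ℚ.< ε

private
  module S = +-*-Solver

  p≤∣p∣ : ∀ p → p ℚ.≤ ℚ.∣ p ∣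
  p≤∣p∣ p with ℚ.≤-total 0ℚ p
  ... | inj₁ 0≤p = ℚ.≤-reflexive (sym (ℚ.0≤p⇒∣p∣≡p 0≤p))
  ... | inj₂ p≤0 = ℚ.≤-trans p≤0 (ℚ.0≤∣p∣ p)

  ∣p∣-∣q∣≤∣p-q∣ : ∀ p q → ℚ.∣ p ∣ ℚ.- ℚ.∣ q ∣ ℚ.≤ ℚ.∣ p ℚ.- q ∣
  ∣p∣-∣q∣≤∣p-q∣ p q = subst₂ ℚ._≤_
    (cong (λ t → ℚ.∣ t ∣ ℚ.- ℚ.∣ q ∣)
      (S.solve 2 (λ p q → (p S.:- q) S.:+ q S.:= p) refl p q))
    (S.solve 2 (λ a b → (a S.:+ b) S.:- b S.:= a) refl ℚ.∣ p ℚ.- q ∣ ℚ.∣ q ∣)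
    (ℚ.+-monoˡ-≤ (ℚ.- ℚ.∣ q ∣) (ℚ.∣p+q∣≤∣p∣+∣q∣ (p ℚ.- q) q))

  p+r≤q⇒r≤q-p : ∀ {p q r} → p ℚ.+ r ℚ.≤ q → r ℚ.≤ q ℚ.- p
  p+r≤q⇒r≤q-p {p} {q} {r} p+r≤q = subst (ℚ._≤ q ℚ.- p)
    (S.solve 2 (λ p r → (p S.:+ r) S.:- p S.:= r) refl p r)
    (ℚ.+-monoˡ-≤ (ℚ.- p) p+r≤q)

  swap-diff : ∀ p q → ℚ.- (p ℚ.- q) ≡ q ℚ.- p
  swap-diff = S.solve 2 (λ p q → S.:- (p S.:- q) S.:= q S.:- p) refl

  0<½*p : ∀ {p} → 0ℚ ℚ.< p → 0ℚ ℚ.< ½ ℚ.* p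
  0<½*p {p} 0<p = subst (ℚ._< ½ ℚ.* p) (ℚ.*-zeroʳ ½) (ℚ.*-monoʳ-<-pos ½ 0<p)

  ½*p+½*p : ∀ p → ½ ℚ.* p ℚ.+ ½ ℚ.* p ≡ p
  ½*p+½*p p = trans (sym (ℚ.*-distribʳ-+ p ½ ½)) (ℚ.*-identityˡ p)

≲-trans : ∀ {x y z} → x ≲ y → y ≲ z → x ≲ z
≲-trans {x} {y} {z} x≲y y≲z ε 0<ε =
  let M , xy = x≲y (½ ℚ.* ε) (0<½*p 0<ε)
      N , yz = y≲z (½ ℚ.* ε) (0<½*p 0<ε)
  in M ℕ.⊔ N , λ n M⊔N≤n → subst₂ ℚ._<_
       (S.solve 3 (λ a b c → (a S.:- b) S.:+ (b S.:- c) S.:= a S.:- c) refl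
         (seq x n) (seq y n) (seq z n))
       (½*p+½*p ε)
       (ℚ.+-mono-< (xy n (ℕ.m⊔n≤o⇒m≤o M N M⊔N≤n)) (yz n (ℕ.m⊔n≤o⇒n≤o M N M⊔N≤n)))

≈⇒≲ : ∀ {x y} → x ≈ y → x ≲ y
≈⇒≲ x≈y ε 0<ε = let N , close = x≈y ε 0<ε in
  N , λ n N≤n → ℚ.≤-<-trans (p≤∣p∣ _) (close n N≤n)

≲-antisym : ∀ {x y} → x ≲ y → y ≲ x → x ≈ y
≲-antisym {x} {y} x≲y y≲x ε 0<ε =
  let M , xy = x≲y ε 0<ε
      N , yx = y≲x ε 0<ε
  in M ℕ.⊔ N , λ n M⊔N≤n →
       [ (λ eq → subst (ℚ._< ε) (sym eq) (xy n (ℕ.m⊔n≤o⇒m≤o M N M⊔N≤n)))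
       , (λ eq → subst (ℚ._< ε) (sym (trans eq (swap-diff (seq x n) (seq y n))))
                   (yx n (ℕ.m⊔n≤o⇒n≤o M N M⊔N≤n)))
       ]′ (ℚ.∣p∣≡p∨∣p∣≡-p (seq x n ℚ.- seq y n))

<⇒≴ : ∀ {x y} → x < y → ¬ (y ≲ x)
<⇒≴ {x} {y} (δ , 0<δ , M , gap) y≲x =
  -- The gap δ itself is the tolerance: at an index past both thresholds the same difference is at
  -- least δ and below δ.
  let N , yx = y≲x δ 0<δ
      n = M ℕ.⊔ N
  in ℚ.<-irrefl refl (ℚ.≤-<-trans
       (p+r≤q⇒r≤q-p {seq x n} {seq y n} (gap n (ℕ.m≤m⊔n M N))) (yx n (ℕ.m≤n⊔m M N)))

<⇒≲ : ∀ {x y} → x < y → x ≲ y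
<⇒≲ {x} {y} (δ , 0<δ , N , gap) ε 0<ε = N , λ n N≤n →
  ℚ.≤-<-trans
    (subst (seq x n ℚ.- seq y n ℚ.≤_) (ℚ.+-inverseʳ (seq y n))
      (ℚ.+-monoˡ-≤ (ℚ.- seq y n)
        (ℚ.≤-trans
          (subst (ℚ._≤ seq x n ℚ.+ δ) (ℚ.+-identityʳ (seq x n))
            (ℚ.+-monoʳ-≤ (seq x n) (ℚ.<⇒≤ 0<δ)))
          (gap n N≤n))))
    0<ε

≈-refl : ∀ {x} → x ≈ x
≈-refl {x} ε 0<ε = 0 , λ n _ →
  subst (ℚ._< ε) (sym (cong ℚ.∣_∣ (ℚ.+-inverseʳ (seq x n)))) 0<ε

≈-reflexive : ∀ {x y} → x ≡ y → x ≈ y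
≈-reflexive {x} refl = ≈-refl {x}

≈-sym : ∀ {x y} → x ≈ y → y ≈ x
≈-sym {x} {y} x≈y ε 0<ε = let N , close = x≈y ε 0<ε in
  N , λ n N≤n → subst (ℚ._< ε)
    (trans (sym (ℚ.∣-p∣≡∣p∣ (seq x n ℚ.- seq y n)))
           (cong ℚ.∣_∣ (swap-diff (seq x n) (seq y n))))
    (close n N≤n)

≈-trans : ∀ {x y z} → x ≈ y → y ≈ z → x ≈ z
≈-trans {x} {y} {z} x≈y y≈z = ≲-antisym {x} {z}
  (≲-trans {x} {y} {z} (≈⇒≲ {x} {y} x≈y) (≈⇒≲ {y} {z} y≈z))
  (≲-trans {z} {y} {x} (≈⇒≲ {z} {y} (≈-sym {y} {z} y≈z)) (≈⇒≲ {y} {x} (≈-sym {x} {y} x≈y)))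

∣-∣-cong : ∀ {x y} → x ≈ y → ∣ x ∣ ≈ ∣ y ∣
∣-∣-cong {x} {y} x≈y = ≲-antisym {∣ x ∣} {∣ y ∣} (mono x y x≈y) (mono y x (≈-sym {x} {y} x≈y))
  where
  mono : ∀ x y → x ≈ y → ∣ x ∣ ≲ ∣ y ∣
  mono x y x≈y ε 0<ε = let N , close = x≈y ε 0<ε in
    N , λ n N≤n → ℚ.≤-<-trans (∣p∣-∣q∣≤∣p-q∣ (seq x n) (seq y n)) (close n N≤n)

eventually-≡⇒≈ : ∀ x y N → (∀ n → N ℕ.≤ n → seq x n ≡ seq y n) → x ≈ y
eventually-≡⇒≈ x y N x≡y ε 0<ε = N , λ n N≤n → subst (ℚ._< ε)
  (sym (cong ℚ.∣_∣ (trans (cong (ℚ._- seq y n) (x≡y n N≤n)) (ℚ.+-inverseʳ (seq y n)))))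
  0<ε

-- Early terms of a positive real may be negative; from `N` on they are at least δ, so the absolute
-- value fixes them.
0<x⇒∣x∣≈x : ∀ {x} → 0ℝ < x → ∣ x ∣ ≈ x
0<x⇒∣x∣≈x {x} (δ , 0<δ , N , gap) = eventually-≡⇒≈ ∣ x ∣ x N λ n N≤n →
  ℚ.0≤p⇒∣p∣≡p (ℚ.≤-trans (ℚ.<⇒≤ 0<δ) (subst (ℚ._≤ seq x n) (ℚ.+-identityˡ δ) (gap n N≤n)))

∣-x∣≈∣x∣ : ∀ x → ∣ - x ∣ ≈ ∣ x ∣
∣-x∣≈∣x∣ x = eventually-≡⇒≈ ∣ - x ∣ ∣ x ∣ 0 λ n _ → ℚ.∣-p∣≡∣p∣ (seq x n)

0<x⇒-x<0 : ∀ {x} → 0ℝ < x → - x < 0ℝ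
0<x⇒-x<0 {x} (δ , 0<δ , N , gap) = δ , 0<δ , N , λ n N≤n →
  subst₂ ℚ._≤_ (ℚ.+-comm δ (ℚ.- seq x n)) (ℚ.+-inverseʳ (seq x n))
    (ℚ.+-monoˡ-≤ (ℚ.- seq x n) (subst (ℚ._≤ seq x n) (ℚ.+-identityˡ δ) (gap n N≤n)))

-- Otherwise 0 < x ≲ -y ≲ 0. This separates the two blocks of `𝓑` and keeps -x₁ out of `𝓑⁺`.
0<x∧0<y⇒x≉-y : ∀ {x y} → 0ℝ < x → 0ℝ < y → x ≉ - y
0<x∧0<y⇒x≉-y {x} {y} 0<x 0<y x≈-y = <⇒≴ {0ℝ} {x} 0<x
  (≲-trans {x} { - y} {0ℝ} (≈⇒≲ {x} { - y} x≈-y) (<⇒≲ { - y} {0ℝ} (0<x⇒-x<0 {y} 0<y)))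

-- Edge connectivity

module _ {A : Set} (G : SimpleGraph A) where

  -- Once uv is deleted, no edge leaves `u`, and `v` differs from `u` by irreflexivity, so no path
  -- joins them.
  pendant⇒disconnecting : ∀ {u v} → Adj G u v → (∀ {w} → Adj G u w → w ≡ v) →
    IsDisconnectingSet G ((u , v) ∷ [])
  pendant⇒disconnecting {u} {v} uv only-v =
    (uv ∷ [] , [] ∷ []) , inj₁ λ (_ , path) →
      isolated (path (adj-vertex G uv) (adj-vertex G (adj-sym G uv)))
    where
    isolated : ¬ Star (Adj (deleteEdges G ((u , v) ∷ []))) u v
    isolated nil              = adj-irrefl G uv
    isolated ((uw , uw∉) ◅ _) = uw∉ (here (inj₁ (cong (u ,_) (only-v uw))))

  -- Deleting nothing preserves all paths, and the ends of the edge uv are two distinct vertices, so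
  -- the graph is not trivial either.
  ∅-not-disconnecting : ∀ {u v} → Connected G → Adj G u v → ¬ IsDisconnectingSet G []
  ∅-not-disconnecting (z , paths) uv (_ , inj₁ disconnected) =
    disconnected (z , λ u∈G v∈G → gmap id (λ e → e , λ ()) (paths u∈G v∈G))
  ∅-not-disconnecting _ uv (_ , inj₂ trivial)
    with trivial (adj-vertex G uv) (adj-vertex G (adj-sym G uv))
  ... | refl = adj-irrefl G uv

  pendant⇒edgeConnectivity-1 : ∀ {u v} → Connected G → Adj G u v →
    (∀ {w} → Adj G u w → w ≡ v) → EdgeConnectivity G 1
  pendant⇒edgeConnectivity-1 connected uv only-v =
    (_ , pendant⇒disconnecting uv only-v , refl) ,
    λ { []      disc → contradiction disc (∅-not-disconnecting connected uv)
      ; (_ ∷ _) _    → s≤s z≤n }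

-- Subsets of finite sets

∈-++⁺ˡ : ∀ {m n} {p : Subset m} {q : Subset n} {i} → i ∈ₛ p → i ↑ˡ n ∈ₛ p ++ q
∈-++⁺ˡ here        = here
∈-++⁺ˡ (there i∈p) = there (∈-++⁺ˡ i∈p)

∈-++⁺ʳ : ∀ {m n} (p : Subset m) {q : Subset n} {j} → j ∈ₛ q → m ↑ʳ j ∈ₛ p ++ q
∈-++⁺ʳ []      j∈q = j∈q
∈-++⁺ʳ (_ ∷ p) j∈q = there (∈-++⁺ʳ p j∈q)

∈-++⁻ : ∀ {m n} (p : Subset m) {q : Subset n} {i} → i ∈ₛ p ++ q →
  (∃[ j ] j ∈ₛ p × i ≡ j ↑ˡ n) ⊎ (∃[ j ] j ∈ₛ q × i ≡ m ↑ʳ j)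
∈-++⁻ []      i∈        = inj₂ (_ , i∈ , refl)
∈-++⁻ (_ ∷ p) here      = inj₁ (zero , here , refl)
∈-++⁻ (_ ∷ p) (there i∈) with ∈-++⁻ p i∈
... | inj₁ (j , j∈p , refl) = inj₁ (suc j , there j∈p , refl)
... | inj₂ (j , j∈q , refl) = inj₂ (j , j∈q , refl)

card-++-⊥ : ∀ {m} n (p : Subset m) → card (p ++ ⊥ {n}) ≡ card p
card-++-⊥ n []            = ∣⊥∣≡0 n
card-++-⊥ n (inside  ∷ p) = cong suc (card-++-⊥ n p)
card-++-⊥ n (outside ∷ p) = card-++-⊥ n p

⊆∧card≡⇒≡ : ∀ {n} {p q : Subset n} → p ⊆ₛ q → card p ≡ card q → p ≡ q
⊆∧card≡⇒≡ {p = p} {q} p⊆q eq = ⊆-antisym p⊆q q⊆p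
  where
  q⊆p : q ⊆ₛ p
  q⊆p {i} i∈q with i ∈? p
  ... | yes i∈p = i∈p
  ... | no  i∉p = contradiction eq (ℕ.<⇒≢ (p⊂q⇒∣p∣<∣q∣ (p⊆q , i , i∈q , i∉p)))

card>0⇒nonempty : ∀ {n} (p : Subset n) → 0 ℕ.< card p → Nonempty p
card>0⇒nonempty (inside  ∷ p) _   = zero , here
card>0⇒nonempty (outside ∷ p) 0<c = let i , i∈p = card>0⇒nonempty p 0<c in suc i , there i∈p

maximum : ∀ {n} (p : Subset n) → Nonempty p → ∃[ t ] t ∈ₛ p × (∀ {i} → i ∈ₛ p → i Fin.≤ t)
maximum (s ∷ p) ne with nonempty? p
maximum (s ∷ p) ne | yes p≢∅ = let t , t∈p , max = maximum p p≢∅ in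
  suc t , there t∈p , λ { here → z≤n ; (there i∈p) → s≤s (max i∈p) }
maximum (s ∷ p) (zero  , here)      | no p≡∅ =
  zero , here , λ { here → z≤n ; (there i∈p) → contradiction (_ , i∈p) p≡∅ }
maximum (s ∷ p) (suc i , there i∈p) | no p≡∅ = contradiction (i , i∈p) p≡∅

-- A greedy scan takes elements of `P` and skips the others. If the quota `k` gets filled, only
-- elements of `P` were taken. If a further skip would leave too few positions, all remaining ones
-- are taken, and then no element of `P` is missed.
comparable : ∀ {n k} {P : Pred (Fin n) 0ℓ} → Decidable P → k ℕ.≤ n →
  ∃[ p ] card p ≡ k × ((∀ {i} → i ∈ₛ p → P i) ⊎ (∀ {i} → P i → i ∈ₛ p))
comparable {n}     {zero}  P? _ = ⊥ , ∣⊥∣≡0 n , inj₁ λ i∈⊥ → contradiction i∈⊥ ∉⊥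
comparable {suc n} {suc k} P? (s≤s k≤n) with P? zero
... | yes P0 = let p , c , cmp = comparable (P? ∘ suc) k≤n in
  inside ∷ p , cong suc c , Sum.map
    (λ p⊆P → λ { here → P0 ; (there i∈p) → p⊆P i∈p })
    (λ P⊆p → λ { {zero} _ → here ; {suc i} Pi → there (P⊆p Pi) })
    cmp
-- The quota is `suc k` and `suc n` positions remain, so equality means that none can be spared.
... | no ¬P0 with k ℕ.≟ n
...   | yes refl = ⊤ , ∣⊤∣≡n (suc n) , inj₂ λ _ → ∈⊤
...   | no  k≢n  = let p , c , cmp = comparable (P? ∘ suc) (ℕ.≤∧≢⇒< k≤n k≢n) in
  outside ∷ p , c , Sum.map
    (λ p⊆P → λ { (there i∈p) → p⊆P i∈p })
    (λ P⊆p → λ { {zero} P0 → contradiction P0 ¬P0 ; {suc i} Pi → there (P⊆p Pi) })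
    cmp

-- Codes of subsets of 𝓑ₙ

positives : ∀ {n} → Subset n → Code n
positives p = p ++ ⊥

-- ∣ 𝓑 x i ∣ is x (index n i).
index : ∀ n → Fin (n ℕ.+ (n ∸ 1)) → Fin n
index n = [ id , (λ j → inject≤ j (ℕ.m∸n≤m n 1)) ]′ ∘ splitAt n

index-↑ˡ : ∀ {n} (i : Fin n) → index n (i ↑ˡ (n ∸ 1)) ≡ i
index-↑ˡ {n} i rewrite Fin.splitAt-↑ˡ n i (n ∸ 1) = refl

index-↑ʳ : ∀ {n} (j : Fin (n ∸ 1)) → index n (n ↑ʳ j) ≡ inject≤ j (ℕ.m∸n≤m n 1)
index-↑ʳ {n} j rewrite Fin.splitAt-↑ʳ n (n ∸ 1) j = refl

∈-positives⁻ : ∀ {n} (p : Subset n) {i} → i ∈ₛ positives p → ∃[ j ] j ∈ₛ p × i ≡ j ↑ˡ (n ∸ 1)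
∈-positives⁻ p i∈ with ∈-++⁻ p i∈
... | inj₁ found           = found
... | inj₂ (_ , j∈⊥ , _) = contradiction j∈⊥ ∉⊥

module _ {n : ℕ} (x : Fin n → ℝ)
  (0<x : ∀ i → 0ℝ < x i) (x-mono : ∀ {i j} → i Fin.< j → x i < x j) where

  x-mono-≲ : ∀ {i j} → i Fin.≤ j → x i ≲ x j
  x-mono-≲ {i} {j} i≤j with i Fin.≟ j
  ... | yes refl = ≈⇒≲ {x i} {x i} (≈-refl {x i})
  ... | no  i≢j  = <⇒≲ {x i} {x j} (x-mono (Fin.≤∧≢⇒< i≤j i≢j))

  x-injective : ∀ {i j} → x i ≈ x j → i ≡ j
  x-injective {i} {j} xi≈xj with Fin.<-cmp i j
  ... | tri< i<j _ _ = contradiction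
    (≈⇒≲ {x j} {x i} (≈-sym {x i} {x j} xi≈xj)) (<⇒≴ {x i} {x j} (x-mono i<j))
  ... | tri≈ _ i≡j _ = i≡j
  ... | tri> _ _ j<i = contradiction
    (≈⇒≲ {x i} {x j} xi≈xj) (<⇒≴ {x j} {x i} (x-mono j<i))

  𝓑-↑ˡ : ∀ i → 𝓑 x (i ↑ˡ (n ∸ 1)) ≡ x i
  𝓑-↑ˡ i rewrite Fin.splitAt-↑ˡ n i (n ∸ 1) = refl

  𝓑-↑ʳ : ∀ j → 𝓑 x (n ↑ʳ j) ≡ - x (inject≤ j (ℕ.m∸n≤m n 1))
  𝓑-↑ʳ j rewrite Fin.splitAt-↑ʳ n (n ∸ 1) j = refl

  ∣𝓑∣≈x∘index : ∀ i → ∣ 𝓑 x i ∣ ≈ x (index n i)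
  ∣𝓑∣≈x∘index i with splitAt n i
  ... | inj₁ j = 0<x⇒∣x∣≈x {x j} (0<x j)
  ... | inj₂ j = let y = x (inject≤ j (ℕ.m∸n≤m n 1)) in
    ≈-trans {∣ - y ∣} {∣ y ∣} {y} (∣-x∣≈∣x∣ y) (0<x⇒∣x∣≈x {y} (0<x _))

  ≈𝓑⇒∣∣≈x∘index : ∀ {r} i → r ≈ 𝓑 x i → ∣ r ∣ ≈ x (index n i)
  ≈𝓑⇒∣∣≈x∘index {r} i r≈𝓑i = ≈-trans {∣ r ∣} {∣ 𝓑 x i ∣} {x (index n i)}
    (∣-∣-cong {r} {𝓑 x i} r≈𝓑i) (∣𝓑∣≈x∘index i)

  -- Equal elements have equal absolute values, which fixes `index`; the sign then decides between
  -- the two blocks.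
  𝓑-injective : ∀ {i j} → 𝓑 x i ≈ 𝓑 x j → i ≡ j
  𝓑-injective {i} {j} 𝓑i≈𝓑j = same-sign 𝓑i≈𝓑j
    (x-injective {index n i} {index n j} (≈-trans {x (index n i)} {∣ 𝓑 x i ∣} {x (index n j)}
      (≈-sym {∣ 𝓑 x i ∣} {x (index n i)} (∣𝓑∣≈x∘index i)) (≈𝓑⇒∣∣≈x∘index {𝓑 x i} j 𝓑i≈𝓑j)))
    where
    -- Both equations are arguments so that one case split reduces them together: `𝓑` and `index`
    -- each compute through `splitAt`.
    same-sign : 𝓑 x i ≈ 𝓑 x j → index n i ≡ index n j → i ≡ j
    same-sign 𝓑i≈𝓑j eq with splitAt n i in eqᵢ | splitAt n j in eqⱼ
    ... | inj₁ i′ | inj₁ j′ = trans (sym (Fin.splitAt⁻¹-↑ˡ eqᵢ))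
      (trans (cong (_↑ˡ (n ∸ 1)) eq) (Fin.splitAt⁻¹-↑ˡ eqⱼ))
    ... | inj₂ i′ | inj₂ j′ = trans (sym (Fin.splitAt⁻¹-↑ʳ {n} eqᵢ))
      (trans (cong (n ↑ʳ_) (Fin.inject≤-injective (ℕ.m∸n≤m n 1) (ℕ.m∸n≤m n 1) i′ j′ eq))
        (Fin.splitAt⁻¹-↑ʳ {n} eqⱼ))
    ... | inj₁ i′ | inj₂ j′ = contradiction 𝓑i≈𝓑j
      (0<x∧0<y⇒x≉-y {x i′} {x (inject≤ j′ _)} (0<x _) (0<x _))
    ... | inj₂ i′ | inj₁ j′ = contradiction (≈-sym { - x (inject≤ i′ _)} {x j′} 𝓑i≈𝓑j)
      (0<x∧0<y⇒x≉-y {x j′} {x (inject≤ i′ _)} (0<x _) (0<x _))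

  -- Vertices are compared by `≡` on codes, so inclusions between sets of reals have to be carried
  -- back to codes. Testing at the points `𝓑 x i` suffices, by injectivity.
  ⟦⟧-⊆⁻ : ∀ {S T} → ⟦_⟧ x S ⊆ ⟦_⟧ x T → S ⊆ₛ T
  ⟦⟧-⊆⁻ {S} {T} S⊆T {i} i∈S =
    let j , j∈T , 𝓑i≈𝓑j = S⊆T {𝓑 x i} (i , i∈S , ≈-refl {𝓑 x i}) in
    subst (_∈ₛ T) (sym (𝓑-injective {i} {j} 𝓑i≈𝓑j)) j∈T

  ∈-†⁺ : ∀ {S r} i → i ∈ₛ S → r ≈ x (index n i) → r ∈ (_†) x S
  ∈-†⁺ {S} {r} i i∈S r≈xi = 𝓑 x i , (i , i∈S , ≈-refl {𝓑 x i}) ,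
    ≈-trans {r} {x (index n i)} {∣ 𝓑 x i ∣} r≈xi
      (≈-sym {∣ 𝓑 x i ∣} {x (index n i)} (∣𝓑∣≈x∘index i))

  ∈-†⁻ : ∀ {S r} → r ∈ (_†) x S → ∃[ i ] i ∈ₛ S × r ≈ x (index n i)
  ∈-†⁻ {S} {r} (a , (i , i∈S , a≈𝓑i) , r≈∣a∣) =
    i , i∈S , ≈-trans {r} {∣ a ∣} {x (index n i)} r≈∣a∣ (≈𝓑⇒∣∣≈x∘index {a} i a≈𝓑i)

  ∈-⟦positives⟧⁺ : ∀ {p : Subset n} {r} i → i ∈ₛ p → r ≈ x i → r ∈ ⟦_⟧ x (positives p)
  ∈-⟦positives⟧⁺ {r = r} i i∈p r≈xi =
    i ↑ˡ (n ∸ 1) , ∈-++⁺ˡ i∈p , subst (r ≈_) (sym (𝓑-↑ˡ i)) r≈xi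

  ∈-⟦positives⟧⁻ : ∀ {p : Subset n} {r} → r ∈ ⟦_⟧ x (positives p) → ∃[ i ] i ∈ₛ p × r ≈ x i
  ∈-⟦positives⟧⁻ {p} {r} (_ , i∈ , r≈) with ∈-positives⁻ p i∈
  ... | j , j∈p , refl = j , j∈p , subst (r ≈_) (𝓑-↑ˡ j) r≈

  positives∈V₁ : ∀ p → positives p ∈ V₁ x (card p)
  positives∈V₁ p =
    (λ {r} r∈ → let i , _ , r≈xi = ∈-⟦positives⟧⁻ {p} {r} r∈ in i , r≈xi) , card-++-⊥ (n ∸ 1) p

  -- Turns `φ` into conditions on indices. Since `x` is injective, distinct indices give distinct
  -- absolute values; since `x` is increasing, the greatest index `t` gives the largest one, and its
  -- place in the first block makes that element positive.
  ∈φ : ∀ S → (∀ {i j} → i ∈ₛ S → j ∈ₛ S → index n i ≡ index n j → i ≡ j) →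
    ∀ t → t ↑ˡ (n ∸ 1) ∈ₛ S → (∀ {i} → i ∈ₛ S → index n i Fin.≤ t) → S ∈ φ x
  ∈φ S index-inj t t∈S max = (x t , xt∈S) , (λ {a} {b} → distinct {a} {b}) ,
    x t , xt∈S , (λ {b} → largest {b}) , 0<x t
    where
    xt∈S : x t ∈ ⟦_⟧ x S
    xt∈S = _ , t∈S , ≈-reflexive (sym (𝓑-↑ˡ t))

    distinct : ∀ {a b} → a ∈ ⟦_⟧ x S → b ∈ ⟦_⟧ x S → a ≉ b → ∣ a ∣ ≉ ∣ b ∣
    distinct {a} {b} (i , i∈S , a≈𝓑i) (j , j∈S , b≈𝓑j) a≉b ∣a∣≈∣b∣ =
      a≉b (≈-trans {a} {𝓑 x i} {b} a≈𝓑i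
        (subst (λ l → 𝓑 x l ≈ b) (sym (index-inj i∈S j∈S (x-injective xi≈xj)))
          (≈-sym {b} {𝓑 x j} b≈𝓑j)))
      where
      xi≈xj : x (index n i) ≈ x (index n j)
      xi≈xj = ≈-trans {x (index n i)} {∣ a ∣} {x (index n j)}
        (≈-sym {∣ a ∣} {x (index n i)} (≈𝓑⇒∣∣≈x∘index {a} i a≈𝓑i))
        (≈-trans {∣ a ∣} {∣ b ∣} {x (index n j)} ∣a∣≈∣b∣ (≈𝓑⇒∣∣≈x∘index {b} j b≈𝓑j))

    largest : ∀ {b} → b ∈ ⟦_⟧ x S → ∣ b ∣ ≤ ∣ x t ∣
    largest {b} (j , j∈S , b≈𝓑j) ∣xt∣<∣b∣ = <⇒≴ {∣ x t ∣} {∣ b ∣} ∣xt∣<∣b∣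
      (≲-trans {∣ b ∣} {x (index n j)} {∣ x t ∣}
        (≈⇒≲ {∣ b ∣} {x (index n j)} (≈𝓑⇒∣∣≈x∘index {b} j b≈𝓑j))
        (≲-trans {x (index n j)} {x t} {∣ x t ∣} (x-mono-≲ (max j∈S))
          (≈⇒≲ {x t} {∣ x t ∣} (≈-sym {∣ x t ∣} {x t} (0<x⇒∣x∣≈x {x t} (0<x t))))))

  positives∈φ : ∀ {p} → Nonempty p → positives p ∈ φ x
  positives∈φ {p} p≢∅ = let t , t∈p , max = maximum p p≢∅ in
    ∈φ (positives p) index-inj t (∈-++⁺ˡ t∈p) (λ i∈ → index≤ max i∈)
    where
    index-inj : ∀ {i j} → i ∈ₛ positives p → j ∈ₛ positives p → index n i ≡ index n j → i ≡ j
    index-inj i∈ j∈ eq with ∈-positives⁻ p i∈ | ∈-positives⁻ p j∈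
    ... | i , _ , refl | j , _ , refl =
      cong (_↑ˡ (n ∸ 1)) (trans (sym (index-↑ˡ i)) (trans eq (index-↑ˡ j)))

    index≤ : ∀ {t} → (∀ {i} → i ∈ₛ p → i Fin.≤ t) → ∀ {i} → i ∈ₛ positives p → index n i Fin.≤ t
    index≤ {t} max i∈ with ∈-positives⁻ p i∈
    ... | j , j∈p , refl = subst (Fin._≤ t) (sym (index-↑ˡ j)) (max j∈p)

  -- Connectedness of the graph

  module _ {k : ℕ} (k<n : k ℕ.< n) where

    𝓑⁺∈V₂ : positives {n} ⊤ ∈ V₂ x k
    -- `k<n` serves twice: it exhibits an element of `Fin n`, and it separates the cardinality n
    -- from `k`.
    𝓑⁺∈V₂ = positives∈φ {⊤} (Fin.fromℕ< k<n , ∈⊤) , λ { (_ , card≡k) →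
      ℕ.<⇒≢ k<n (trans (sym card≡k) (trans (card-++-⊥ {n} (n ∸ 1) ⊤) (∣⊤∣≡n n))) }

    V₁-joined-𝓑⁺ : ∀ {X} → X ∈ V₁ x k → Joined x k X (positives {n} ⊤)
    V₁-joined-𝓑⁺ {X} X∈V₁@(X⊆𝓑⁺ , _) = X∈V₁ , 𝓑⁺∈V₂ , inj₁ λ {r} r∈X →
      let i , r≈xi = X⊆𝓑⁺ {r} r∈X in
      ∈-†⁺ {positives {n} ⊤} {r} (i ↑ˡ (n ∸ 1)) (∈-++⁺ˡ {p = ⊤} ∈⊤)
        (subst (λ j → r ≈ x j) (sym (index-↑ˡ i)) r≈xi)

    V₂-joined : ∀ {Y} → Y ∈ V₂ x k → ∃[ X ] Joined x k X Y
    V₂-joined {Y} Y∈V₂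
      -- This predicate is the index set of `Y †`, so the two alternatives of `comparable` become
      -- the two alternatives of `Joined`.
      with comparable {P = λ i → ∃[ j ] j ∈ₛ Y × index n j ≡ i}
             (λ i → Fin.any? λ j → (j ∈? Y) ×-dec (index n j Fin.≟ i)) (ℕ.<⇒≤ k<n)
    ... | p , refl , cmp = positives p , positives∈V₁ p , Y∈V₂ , Sum.map below above cmp
      where
      below : (∀ {i} → i ∈ₛ p → ∃[ j ] j ∈ₛ Y × index n j ≡ i) → ⟦_⟧ x (positives p) ⊆ (_†) x Y
      below p⊆ {r} r∈ =
        let i , i∈p , r≈xi = ∈-⟦positives⟧⁻ {p} {r} r∈
            j , j∈Y , j↦i = p⊆ i∈p
        in ∈-†⁺ {Y} {r} j j∈Y (subst (λ l → r ≈ x l) (sym j↦i) r≈xi)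

      above : (∀ {i} → ∃[ j ] j ∈ₛ Y × index n j ≡ i → i ∈ₛ p) → (_†) x Y ⊆ ⟦_⟧ x (positives p)
      above ⊆p {r} r∈ = let j , j∈Y , r≈xj = ∈-†⁻ {Y} {r} r∈ in
        ∈-⟦positives⟧⁺ {p} {r} (index n j) (⊆p (j , j∈Y , refl)) r≈xj

    -- The vertex `positives ⊤` is a hub: one edge leads to it from `V₁`, and two edges, by way of
    -- `V₁`, from `V₂`.
    H_B-connected : Connected (H_B n k x)
    H_B-connected = (positives {n} ⊤ , inj₂ 𝓑⁺∈V₂) , λ u∈ v∈ → to u∈ ◅◅ from v∈
      where
      to : ∀ {u} → u ∈ Vertex (H_B n k x) → Star (Adj (H_B n k x)) u (positives {n} ⊤)
      to {u} (inj₁ u∈V₁) = return (fwd (V₁-joined-𝓑⁺ {u} u∈V₁))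
      to {u} (inj₂ u∈V₂) = let X , Xu = V₂-joined {u} u∈V₂ in
        bwd Xu ◅ return (fwd (V₁-joined-𝓑⁺ {X} (proj₁ Xu)))

      from : ∀ {u} → u ∈ Vertex (H_B n k x) → Star (Adj (H_B n k x)) (positives {n} ⊤) u
      from {u} (inj₁ u∈V₁) = return (bwd (V₁-joined-𝓑⁺ {u} u∈V₁))
      from {u} (inj₂ u∈V₂) = let X , Xu = V₂-joined {u} u∈V₂ in
        bwd (V₁-joined-𝓑⁺ {X} (proj₁ Xu)) ◅ return (fwd Xu)

-- A pendant vertex and its only neighbour

flipLeast : ∀ {m} → Subset (suc m) → Code (suc (suc m))
-- Position `zero` stands for x₁ in the first block and for -x₁ in the second; `p` selects among x₂,
-- ..., xₙ.
flipLeast p = (outside ∷ p) ++ ⁅ zero ⁆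

∈-flipLeast⁻ : ∀ {m} (p : Subset (suc m)) {i} → i ∈ₛ flipLeast p →
  (∃[ j ] j ∈ₛ p × i ≡ suc j ↑ˡ suc m) ⊎ (i ≡ suc (suc m) ↑ʳ zero)
∈-flipLeast⁻ p i∈ with ∈-++⁻ (outside ∷ p) i∈
... | inj₁ (suc j , there j∈p , refl) = inj₁ (j , j∈p , refl)
... | inj₂ (j , j∈ , refl) with x∈⁅y⁆⇒x≡y zero j∈
...   | refl = inj₂ refl

module _ {m : ℕ} (x : Fin (suc (suc m)) → ℝ)
  (0<x : ∀ i → 0ℝ < x i) (x-mono : ∀ {i j} → i Fin.< j → x i < x j)
  {p : Subset (suc m)} (p≢∅ : Nonempty p) where

  private
    k : ℕ
    k = suc (card p)

    least : Fin (suc (suc m) ℕ.+ suc m)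
    least = suc (suc m) ↑ʳ zero

    least∈ : least ∈ₛ flipLeast p
    least∈ = ∈-++⁺ʳ (outside ∷ p) (x∈⁅x⁆ zero)

    index-least : index (suc (suc m)) least ≡ zero
    index-least = index-↑ʳ {suc (suc m)} zero

  -- Here k ≥ 2 enters, through `p≢∅`: the largest absolute value belongs to a positive element
  -- chosen by `p`, and not to -x₁.
  flipLeast∈φ : flipLeast p ∈ φ x
  flipLeast∈φ = let t , t∈p , max = maximum p p≢∅ in
    ∈φ x 0<x x-mono (flipLeast p) index-inj (suc t) (∈-++⁺ˡ (there t∈p)) (λ i∈ → index≤ max i∈)
    where
    index-inj : ∀ {i j} → i ∈ₛ flipLeast p → j ∈ₛ flipLeast p →
      index (suc (suc m)) i ≡ index (suc (suc m)) j → i ≡ j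
    index-inj i∈ j∈ eq with ∈-flipLeast⁻ p i∈ | ∈-flipLeast⁻ p j∈
    ... | inj₂ refl           | inj₂ refl           = refl
    ... | inj₁ (i , _ , refl) | inj₁ (j , _ , refl) =
      cong (_↑ˡ suc m) (trans (sym (index-↑ˡ (suc i))) (trans eq (index-↑ˡ (suc j))))
    -- Elements from `p` have successor indices, while -x₁ has index `zero`.
    ... | inj₁ (i , _ , refl) | inj₂ refl =
      contradiction (trans (sym (index-↑ˡ (suc i))) (trans eq index-least)) λ ()
    ... | inj₂ refl           | inj₁ (j , _ , refl) =
      contradiction (trans (sym index-least) (trans eq (index-↑ˡ (suc j)))) λ ()

    index≤ : ∀ {t} → (∀ {i} → i ∈ₛ p → i Fin.≤ t) →
      ∀ {i} → i ∈ₛ flipLeast p → index (suc (suc m)) i Fin.≤ suc t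
    index≤ {t} max i∈ with ∈-flipLeast⁻ p i∈
    ... | inj₁ (j , j∈p , refl) = subst (Fin._≤ suc t) (sym (index-↑ˡ (suc j))) (s≤s (max j∈p))
    ... | inj₂ refl             = subst (Fin._≤ suc t) (sym index-least) z≤n

  -- Cardinality cannot decide this, as `flipLeast p` has exactly `k` elements; the element -x₁
  -- does.
  flipLeast∉V₁ : ∀ {l} → ¬ (flipLeast p ∈ V₁ x l)
  flipLeast∉V₁ (⊆𝓑⁺ , _) =
    let i , -x₁≈xi = ⊆𝓑⁺ { - x zero}
          (least , least∈ , ≈-reflexive (sym (𝓑-↑ʳ x 0<x x-mono zero)))
    in 0<x∧0<y⇒x≉-y {x i} {x zero} (0<x i) (0<x zero) (≈-sym { - x zero} {x i} -x₁≈xi)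

  -- With `⊆flipLeast†` this identifies the two sets: dropping the sign of -x₁ restores x₁.
  flipLeast†⊆ : (_†) x (flipLeast p) ⊆ ⟦_⟧ x (positives (inside ∷ p))
  flipLeast†⊆ {r} r∈ = let i , i∈ , r≈ = ∈-†⁻ x 0<x x-mono {flipLeast p} {r} r∈ in by-index i∈ r≈
    where
    by-index : ∀ {i} → i ∈ₛ flipLeast p → r ≈ x (index (suc (suc m)) i) →
      r ∈ ⟦_⟧ x (positives (inside ∷ p))
    by-index i∈ r≈ with ∈-flipLeast⁻ p i∈
    ... | inj₁ (j , j∈p , refl) = ∈-⟦positives⟧⁺ x 0<x x-mono {inside ∷ p} {r} (suc j) (there j∈p)
      (subst (λ l → r ≈ x l) (index-↑ˡ (suc j)) r≈)
    ... | inj₂ refl = ∈-⟦positives⟧⁺ x 0<x x-mono {inside ∷ p} {r} zero here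
      (subst (λ l → r ≈ x l) index-least r≈)

  ⊆flipLeast† : ⟦_⟧ x (positives (inside ∷ p)) ⊆ (_†) x (flipLeast p)
  ⊆flipLeast† {r} r∈ =
    let i , i∈ , r≈ = ∈-⟦positives⟧⁻ x 0<x x-mono {inside ∷ p} {r} r∈ in by-index i∈ r≈
    where
    by-index : ∀ {i} → i ∈ₛ inside ∷ p → r ≈ x i → r ∈ (_†) x (flipLeast p)
    by-index here r≈ = ∈-†⁺ x 0<x x-mono {flipLeast p} {r} least least∈
      (subst (λ l → r ≈ x l) (sym index-least) r≈)
    by-index {suc j} (there j∈p) r≈ =
      ∈-†⁺ x 0<x x-mono {flipLeast p} {r} (suc j ↑ˡ suc m) (∈-++⁺ˡ {p = outside ∷ p} (there j∈p))
        (subst (λ l → r ≈ x l) (sym (index-↑ˡ (suc j))) r≈)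

  flipLeast-adjacent : Adj (H_B (suc (suc m)) k x) (flipLeast p) (positives (inside ∷ p))
  flipLeast-adjacent = bwd
    ( positives∈V₁ x 0<x x-mono (inside ∷ p)
    , (flipLeast∈φ , flipLeast∉V₁)
    , inj₁ λ {r} → ⊆flipLeast† {r} )

  -- A neighbour `Z` lies in `V₁`, hence has `k` elements, and is comparable with a set of `k`
  -- elements. Whichever way the inclusion goes, equal cardinalities force equality.
  flipLeast-pendant : ∀ {Z} → Adj (H_B (suc (suc m)) k x) (flipLeast p) Z →
    Z ≡ positives (inside ∷ p)
  flipLeast-pendant (fwd (Y∈V₁ , _)) = contradiction Y∈V₁ flipLeast∉V₁
  flipLeast-pendant {Z} (bwd ((_ , card≡k) , _ , inj₁ Z⊆Y†)) =
    ⊆∧card≡⇒≡ (⟦⟧-⊆⁻ x 0<x x-mono {Z} {positives (inside ∷ p)}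
        λ {r} r∈Z → flipLeast†⊆ {r} (Z⊆Y† {r} r∈Z))
      (trans card≡k (sym (card-++-⊥ (suc m) (inside ∷ p))))
  flipLeast-pendant {Z} (bwd ((_ , card≡k) , _ , inj₂ Y†⊆Z)) =
    sym (⊆∧card≡⇒≡ (⟦⟧-⊆⁻ x 0<x x-mono {positives (inside ∷ p)} {Z}
        λ {r} r∈X → Y†⊆Z {r} (⊆flipLeast† {r} r∈X))
      (trans (card-++-⊥ (suc m) (inside ∷ p)) (sym card≡k)))

mainTheorem7 : (n k : ℕ) → 3 ℕ.≤ n → 1 ℕ.< k → k ℕ.< n →
    (x : Fin n → ℝ) →
    (∀ i → 0ℝ < x i) →
    (∀ {i j} → i Fin.< j → x i < x j) →
    EdgeConnectivity (H_B n k x) 1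
mainTheorem7 (suc (suc m)) (suc k) _ (s≤s 0<k) k<n x 0<x x-mono
  -- Applied to the full set, `comparable` supplies some `p` of `k` elements among x₂, ..., xₙ;
  -- adding x₁ or -x₁ brings the count to `suc k`, the parameter of the graph.
  with comparable {P = _∈ₛ ⊤} (_∈? ⊤) (ℕ.<⇒≤ (ℕ.s≤s⁻¹ k<n))
... | p , refl , _ = pendant⇒edgeConnectivity-1 (H_B (suc (suc m)) (suc (card p)) x)
  (H_B-connected x 0<x x-mono k<n)
  (flipLeast-adjacent x 0<x x-mono p≢∅)
  (flipLeast-pendant x 0<x x-mono p≢∅)
  where
  p≢∅ : Nonempty p
  p≢∅ = card>0⇒nonempty p 0<k
mainTheorem7 zero                _ ()
mainTheorem7 (suc zero)          _ (s≤s ())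
mainTheorem7 (suc (suc m)) zero  _ ()
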